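{- Let $k\ge 3$ and let $n\le N$ be positive integers. Then $\alpha_k(n,N)\le\overline{\alpha}_k(n,N)$, and if $N>(k-1)(n-1)$ then $\alpha_k(n,N)=\overline{\alpha}_k(n,N)$.
   Context: $[n]=\{1,\dots,n\}$. A line in $[n]^{k-1}\times[N]$ is a set obtained by fixing all coordinates but one and letting the remaining one vary over its whole range. A linjection $f:[n]^{k-1}\times[N]\to\{0,1\}$ (with $N\ge n$) is a function such that for every $(x_1,\dots,x_{k-1})\in[n]^{k-1}$ there is exactly one $b\in[N]$ with $f(x_1,\dots,x_{k-1},b)=1$, and every line contains at most one point at which $f=1$. In $X_1\times\cdots\times X_k$ with $X_1=\dots=X_{k-1}=[n]$, $X_k=[N]$, a cylinder in dimension $i$ is a subset closed under arbitrary changes of the $i$-th coordinate, and a cylinder intersection is a set $\bigcap_{i=1}^kT_i$ with $T_i$ a cylinder in dimension $i$. $\alpha_k(f)$ is the largest cardinality of a cylinder intersection contained in $f^{ -1}(1)$, and $\alpha_k(n,N)=\max_f\alpha_k(f)$ over all linjections $f:[n]^{k-1}\times[N]\to\{0,1\}$. Consider $k$-partite $(k-1)$-uniform hypergraphs $H$ with $k-1$ parts of size $n$ and one part of size $N$ (each hyperedge has at most one vertex in each part). A clique in $H$ is a set of $k$ vertices every $k-1$ of which form a hyperedge. $\overline{\alpha}_k(H)$ is the largest size of a family $K$ of cliques in $H$ such that (i) no two cliques in $K$ share a hyperedge, and (ii) the hypergraph consisting of all hyperedges of the cliques in $K$ contains no cliques other than those in $K$. $\overline{\alpha}_k(n,N)=\max_H\overline{\alpha}_k(H)$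 over all such $H$. -}

module Defs where

open import Data.Bool using (Bool; true; false; if_then_else_)
import Data.Bool.Properties as Bool
open import Data.Fin using (Fin; zero; suc; splitAt; quotient)
import Data.Fin.Properties as Fin
import Data.Fin.Subset as Sub
import Data.Fin.Subset.Properties as Sub
open import Data.List using (List; []; _∷_; map; filter; length; allFin; cartesianProduct; cartesianProductWith)
open import Data.List.Extrema.Nat using (max; argmax-sel; xs≤max)
open import Data.List.Membership.Propositional using (_∈_; find; lose)
open import Data.List.Membership.Propositional.Properties
  using (∈-allFin; ∈-cartesianProduct⁺; ∈-cartesianProductWith⁺; ∈-filter⁺; ∈-filter⁻; ∈-map⁺; ∈-map⁻)
import Data.List.Relation.Unary.All as All
import Data.List.Relation.Unary.AllPairs as AllPairs
import Data.List.Relation.Unary.Any as Any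
open import Data.List.Relation.Unary.Any using (here; there)
open import Data.List.Relation.Unary.Unique.Propositional using (Unique)
import Data.List.Relation.Unary.Unique.Propositional.Properties as Unique
open import Data.Nat using (ℕ; zero; suc; _+_; _*_; _∸_; _≤_)
import Data.Nat.Properties as ℕ
open import Data.Product using (∃; ∃!; _×_; _,_; proj₂)
import Data.Product.Properties as Product
open import Data.Sum using (_⊎_; inj₁; inj₂; [_,_]′)
open import Data.Vec using (Vec; []; _∷_; lookup)
import Data.Vec.Properties as Vec
open import Function using (_∘_; const; case_of_)
open import Function.Bundles using (_⇔_; mk⇔; Equivalence)
open import Relation.Binary.Definitions using (DecidableEquality)
open import Relation.Binary.PropositionalEquality using (_≡_; _≢_; _≗_; refl; sym; trans; subst)
open import Relation.Nullary using (Dec; yes; no; does; ¬?; _×-dec_; _→-dec_)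
import Relation.Nullary.Decidable as Dec
open import Relation.Unary using (Decidable)

record Finite (A : Set) : Set where
  field
    elements : List A
    unique   : Unique elements
    complete : ∀ x → x ∈ elements
    _≟_      : DecidableEquality A

open Finite ⦃ ... ⦄

instance
  finiteBool : Finite Bool
  finiteBool = record
    { elements = true ∷ false ∷ []
    ; unique   = ((λ ()) All.∷ All.[]) AllPairs.∷ All.[] AllPairs.∷ AllPairs.[]
    ; complete = λ { true → here refl ; false → there (here refl) }
    ; _≟_      = Bool._≟_
    }

  finiteFin : ∀ {n} → Finite (Fin n)
  finiteFin {n} = record
    { elements = allFin n
    ; unique   = Unique.allFin⁺ n
    ; complete = ∈-allFin
    ; _≟_      = Fin._≟_
    }

  finite× : ∀ {A B} → ⦃ Finite A ⦄ → ⦃ Finite B ⦄ → Finite (A × B)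
  finite× = record
    { elements = cartesianProduct elements elements
    ; unique   = Unique.cartesianProduct⁺ unique unique
    ; complete = λ (x , y) → ∈-cartesianProduct⁺ (complete x) (complete y)
    ; _≟_      = Product.≡-dec _≟_ _≟_
    }

  finiteVec : ∀ {A m} → ⦃ Finite A ⦄ → Finite (Vec A m)
  finiteVec {A} = record
    { elements = vecs _
    ; unique   = vecs-unique _
    ; complete = vecs-complete
    ; _≟_      = Vec.≡-dec _≟_
    }
    where
    vecs : ∀ m → List (Vec A m)
    vecs zero    = [] ∷ []
    vecs (suc m) = cartesianProductWith _∷_ elements (vecs m)

    vecs-unique : ∀ m → Unique (vecs m)
    vecs-unique zero    = All.[] AllPairs.∷ AllPairs.[]
    vecs-unique (suc m) =
      Unique.cartesianProductWith⁺ _∷_ Vec.∷-injective unique (vecs-unique m)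

    vecs-complete : ∀ {m} (xs : Vec A m) → xs ∈ vecs m
    vecs-complete []       = here refl
    vecs-complete (x ∷ xs) = ∈-cartesianProductWith⁺ _∷_ (complete x) (vecs-complete xs)

∀? : ∀ {A} ⦃ _ : Finite A ⦄ {P : A → Set} → Decidable P → Dec (∀ x → P x)
∀? P? = Dec.map′ (λ ps x → All.lookup ps (complete x)) (λ p → All.tabulate (λ {x} _ → p x))
                 (All.all? P? elements)

∃? : ∀ {A} ⦃ _ : Finite A ⦄ {P : A → Set} → Decidable P → Dec (∃ P)
∃? P? = Dec.map′ (λ p → let x , _ , px = find p in x , px) (λ (x , px) → lose (complete x) px)
                 (Any.any? P? elements)

_⇔-dec_ : ∀ {P Q : Set} → Dec P → Dec Q → Dec (P ⇔ Q)
P? ⇔-dec Q? = Dec.map′ (λ (f , g) → mk⇔ f g) (λ e → Equivalence.to e , Equivalence.from e)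
                       ((P? →-dec Q?) ×-dec (Q? →-dec P?))

∃!? : ∀ {A} ⦃ _ : Finite A ⦄ {P : A → Set} → Decidable P → Dec (∃! _≡_ P)
∃!? P? = ∃? λ x → P? x ×-dec
  Dec.map′ (λ h {y} → h y) (λ h y → h {y}) (∀? λ y → P? y →-dec (x ≟ y))

-- Subsets of a finite type, equivalently 0/1-valued functions on it.
SetOf : Set → Set
SetOf A = A → Bool

infix 4 _∈ˢ_ _⊆ˢ_

_∈ˢ_ : ∀ {A} → A → SetOf A → Set
x ∈ˢ S = S x ≡ true

_∈ˢ?_ : ∀ {A} (x : A) (S : SetOf A) → Dec (x ∈ˢ S)
x ∈ˢ? S = S x Bool.≟ true

_⊆ˢ_ : ∀ {A} → SetOf A → SetOf A → Set
S ⊆ˢ T = ∀ x → x ∈ˢ S → x ∈ˢ T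

_⊆ˢ?_ : ∀ {A} ⦃ _ : Finite A ⦄ (S T : SetOf A) → Dec (S ⊆ˢ T)
S ⊆ˢ? T = ∀? λ x → (x ∈ˢ? S) →-dec (x ∈ˢ? T)

card : ∀ {A} → ⦃ Finite A ⦄ → SetOf A → ℕ
card S = length (filter (_∈ˢ? S) elements)

module _ {A : Set} ⦃ _ : Finite A ⦄ where

  update : A → Bool → SetOf A → SetOf A
  update x b S y = if does (y ≟ x) then b else S y

  subsetsOf : List A → List (SetOf A)
  subsetsOf []       = const false ∷ []
  subsetsOf (x ∷ xs) = cartesianProductWith (update x) elements (subsetsOf xs)

  subsetsOf-complete : ∀ (S : SetOf A) xs → ∃ λ S′ → S′ ∈ subsetsOf xs × (∀ y → y ∈ xs → S′ y ≡ S y)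
  subsetsOf-complete S []       = const false , here refl , λ _ ()
  subsetsOf-complete S (x ∷ xs) =
    let S′ , S′∈ , eq = subsetsOf-complete S xs in
    update x (S x) S′ ,
    ∈-cartesianProductWith⁺ (update x) (complete (S x)) S′∈ ,
    agree S′ eq
    where
    agree : ∀ (S′ : SetOf A) → (∀ y → y ∈ xs → S′ y ≡ S y) → ∀ y → y ∈ x ∷ xs → update x (S x) S′ y ≡ S y
    agree S′ eq y y∈ with y ≟ x | y∈
    ... | yes refl | _         = refl
    ... | no y≢x   | here y≡x  = case y≢x y≡x of λ ()
    ... | no _     | there y∈′ = eq y y∈′

  subsets : List (SetOf A)
  subsets = subsetsOf elements

  subsets-complete : ∀ (S : SetOf A) → ∃ λ S′ → S′ ∈ subsets × S′ ≗ S
  subsets-complete S =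
    let S′ , S′∈ , eq = subsetsOf-complete S elements in S′ , S′∈ , λ y → eq y (complete y)

  Extensional : (SetOf A → Set) → Set
  Extensional P = ∀ {S S′} → S ≗ S′ → P S → P S′

  ∃Set? : {P : SetOf A → Set} → Extensional P → Decidable P → Dec (∃ P)
  ∃Set? ext P? = Dec.map′
    (λ p → let S , _ , pS = find p in S , pS)
    (λ (S , pS) → let S′ , S′∈ , eq = subsets-complete S in lose S′∈ (ext (sym ∘ eq) pS))
    (Any.any? P? subsets)

  -- The maximum of g S over all S satisfying P; it is 0 if there is no such S.
  maximum : (g : SetOf A → ℕ) (P : SetOf A → Set) → Decidable P → ℕ
  maximum g P P? = max 0 (map g (filter P? subsets))

  maximum-upper : ∀ g P (P? : Decidable P) → Extensional P → (∀ {S S′} → S ≗ S′ → g S ≡ g S′) →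
                  ∀ S → P S → g S ≤ maximum g P P?
  maximum-upper g P P? ext gext S pS =
    let S′ , S′∈ , eq = subsets-complete S in
    subst (_≤ maximum g P P?) (gext eq)
      (All.lookup (xs≤max 0 (map g (filter P? subsets)))
        (∈-map⁺ g (∈-filter⁺ P? S′∈ (ext (sym ∘ eq) pS))))

  maximum-attained : ∀ g P (P? : Decidable P) →
                     maximum g P P? ≡ 0 ⊎ (∃ λ S → P S × maximum g P P? ≡ g S)
  maximum-attained g P P? with argmax-sel (λ x → x) 0 (map g (filter P? subsets))
  ... | inj₁ eq = inj₁ eq
  ... | inj₂ m∈ = let S , S∈ , eq = ∈-map⁻ g m∈ in inj₂ (S , proj₂ (∈-filter⁻ P? {xs = subsets} S∈) , eq)

-- Throughout, d = k - 1, so that the k dimensions (or parts) are indexed by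
-- Fin (suc d).  Index zero is the distinguished one, of size N, which is
-- traditionally listed last; the indices suc i are those of size n.
module Cube (d n N : ℕ) where

  Point : Set
  Point = Vec (Fin n) d × Fin N

  dimSize : Fin (suc d) → ℕ
  dimSize zero    = N
  dimSize (suc _) = n

  coord : Point → (i : Fin (suc d)) → Fin (dimSize i)
  coord (xs , b) zero    = b
  coord (xs , b) (suc i) = lookup xs i

  SameOff : Fin (suc d) → Point → Point → Set
  SameOff i x y = ∀ j → j ≢ i → coord x j ≡ coord y j

  SameOff? : ∀ i x y → Dec (SameOff i x y)
  SameOff? i x y = ∀? λ j → ¬? (j ≟ i) →-dec (coord x j ≟ coord y j)

  -- The line in direction i through p consists of the x with OnLine i p x.
  OnLine : Fin (suc d) → Point → Point → Set
  OnLine i p x = SameOff i x p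

  record IsLinjection (f : SetOf Point) : Set where
    constructor linjection
    field
      value  : ∀ xs → ∃! _≡_ λ b → f (xs , b) ≡ true
      sparse : ∀ i p x y → OnLine i p x → OnLine i p y → f x ≡ true → f y ≡ true → x ≡ y

  IsLinjection? : Decidable IsLinjection
  IsLinjection? f = Dec.map′ (λ (v , s) → linjection v s) (λ (linjection v s) → v , s)
    ((∀? λ xs → ∃!? λ b → f (xs , b) Bool.≟ true) ×-dec
     (∀? λ i → ∀? λ p → ∀? λ x → ∀? λ y →
       SameOff? i x p →-dec SameOff? i y p →-dec
       (f x Bool.≟ true) →-dec (f y Bool.≟ true) →-dec (x ≟ y)))

  IsCylinder : Fin (suc d) → SetOf Point → Set
  IsCylinder i T = ∀ x y → SameOff i x y → x ∈ˢ T → y ∈ˢ T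

  IsCylinderIntersection : SetOf Point → Set
  IsCylinderIntersection S = ∃ λ (T : Fin (suc d) → SetOf Point) →
    (∀ i → IsCylinder i (T i)) × (∀ x → x ∈ˢ S ⇔ (∀ i → x ∈ˢ T i))

  IsCylinderIntersection? : Decidable IsCylinderIntersection
  IsCylinderIntersection? S = Dec.map′
    (λ (U , c) → (λ i x → U (i , x)) , c) (λ (T , c) → (λ (i , x) → T i x) , c)
    (∃Set? {A = Fin (suc d) × Point} {P = P} ext P?)
    where
    P : SetOf (Fin (suc d) × Point) → Set
    P U = (∀ i → IsCylinder i (λ x → U (i , x))) × (∀ x → x ∈ˢ S ⇔ (∀ i → (i , x) ∈ˢ U))

    P? : Decidable P
    P? U =
      (∀? λ i → ∀? λ x → ∀? λ y → SameOff? i x y →-dec ((i , x) ∈ˢ? U) →-dec ((i , y) ∈ˢ? U))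
      ×-dec (∀? λ x → (x ∈ˢ? S) ⇔-dec (∀? λ i → (i , x) ∈ˢ? U))

    ext : Extensional P
    ext eq (cyl , int) =
      (λ i x y xy x∈ → trans (sym (eq _)) (cyl i x y xy (trans (eq _) x∈))) ,
      (λ x → mk⇔ (λ x∈ i → trans (sym (eq _)) (Equivalence.to (int x) x∈ i))
                 (λ x∈ → Equivalence.from (int x) (λ i → trans (eq _) (x∈ i))))

  -- A 0/1-valued f is itself the set of points at which it is 1.
  α-of : SetOf Point → ℕ
  α-of f = maximum card (λ S → IsCylinderIntersection S × S ⊆ˢ f)
                        (λ S → IsCylinderIntersection? S ×-dec (S ⊆ˢ? f))

  -- For N ≥ n ≥ 1 linjections exist (f (x , b) = 1 iff b ≡ Σ xᵢ mod N), so
  -- this is the maximum of a nonempty set.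
  max-α : ℕ
  max-α = maximum α-of IsLinjection IsLinjection?

module Hypergraph (d n N : ℕ) where

  v : ℕ
  v = N + d * n

  VertexSet : Set
  VertexSet = Sub.Subset v

  -- The first N vertices form part zero, each following block of n another part.
  part : Fin v → Fin (suc d)
  part u = [ const zero , (λ w → suc (quotient {d} n w)) ]′ (splitAt N u)

  IsPartite : SetOf VertexSet → Set
  IsPartite H = ∀ e → e ∈ˢ H → ∀ u w → u Sub.∈ e → w Sub.∈ e → part u ≡ part w → u ≡ w

  IsUniform : SetOf VertexSet → Set
  IsUniform H = ∀ e → e ∈ˢ H → Sub.∣ e ∣ ≡ d

  -- Here the hypergraph is given by an arbitrary predicate on vertex sets.
  IsClique : (VertexSet → Set) → VertexSet → Set
  IsClique H C = Sub.∣ C ∣ ≡ suc d × (∀ e → e Sub.⊆ C → Sub.∣ e ∣ ≡ d → H e)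

  EdgeOfSome : SetOf VertexSet → SetOf VertexSet → VertexSet → Set
  EdgeOfSome H K e = ∃ λ C → C ∈ˢ K × e ∈ˢ H × e Sub.⊆ C

  record IsGoodFamily (H K : SetOf VertexSet) : Set where
    constructor goodFamily
    field
      cliques  : ∀ C → C ∈ˢ K → IsClique (_∈ˢ H) C
      disjoint : ∀ C D → C ∈ˢ K → D ∈ˢ K → ∀ e → e ∈ˢ H → e Sub.⊆ C → e Sub.⊆ D → C ≡ D
      closed   : ∀ C → IsClique (EdgeOfSome H K) C → C ∈ˢ K

  IsPartite? : Decidable IsPartite
  IsPartite? H = ∀? λ e → (e ∈ˢ? H) →-dec ∀? λ u → ∀? λ w →
    (u Sub.∈? e) →-dec (w Sub.∈? e) →-dec (part u ≟ part w) →-dec (u ≟ w)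

  IsUniform? : Decidable IsUniform
  IsUniform? H = ∀? λ e → (e ∈ˢ? H) →-dec (Sub.∣ e ∣ ℕ.≟ d)

  IsClique? : ∀ {H} → Decidable H → Decidable (IsClique H)
  IsClique? H? C = (Sub.∣ C ∣ ℕ.≟ suc d) ×-dec
    (∀? λ e → (e Sub.⊆? C) →-dec (Sub.∣ e ∣ ℕ.≟ d) →-dec H? e)

  EdgeOfSome? : ∀ H K → Decidable (EdgeOfSome H K)
  EdgeOfSome? H K e = ∃? λ C → (C ∈ˢ? K) ×-dec (e ∈ˢ? H) ×-dec (e Sub.⊆? C)

  IsGoodFamily? : ∀ H → Decidable (IsGoodFamily H)
  IsGoodFamily? H K =
    Dec.map′ (λ (a , b , c) → goodFamily a b c) (λ (goodFamily a b c) → a , b , c)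
      ((∀? λ C → (C ∈ˢ? K) →-dec IsClique? (_∈ˢ? H) C) ×-dec
       (∀? λ C → ∀? λ D → (C ∈ˢ? K) →-dec (D ∈ˢ? K) →-dec
         ∀? λ e → (e ∈ˢ? H) →-dec (e Sub.⊆? C) →-dec (e Sub.⊆? D) →-dec (C ≟ D)) ×-dec
       (∀? λ C → IsClique? (EdgeOfSome? H K) C →-dec (C ∈ˢ? K)))

  ᾱ-of : SetOf VertexSet → ℕ
  ᾱ-of H = maximum card (IsGoodFamily H) (IsGoodFamily? H)

  max-ᾱ : ℕ
  max-ᾱ = maximum ᾱ-of (λ H → IsPartite H × IsUniform H)
                       (λ H → IsPartite? H ×-dec IsUniform? H)

-- Meaningful for k ≥ 1 only.
α : (k n N : ℕ) → ℕ
α k n N = Cube.max-α (k ∸ 1) n N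

ᾱ : (k n N : ℕ) → ℕ
ᾱ k n N = Hypergraph.max-ᾱ (k ∸ 1) n N

{-# OPTIONS --safe #-}

-- A point of the cube is a transversal vertex set, and its d + 1 faces (omit one
-- vertex) are the lines through it.  A cylinder intersection S inside a
-- linjection gives the cliques K = S with the faces of its points as edges:
-- disjointness of cliques is sparseness on lines, and if all faces of p are faces
-- of points of S, then p lies in every cylinder, which is closedness.  Conversely a
-- good family K is a cylinder intersection, with i-th cylinder the points whose
-- i-th face is an edge of K.  Its points have at most one value over each
-- (x₁,…,x_d), so they form a partial proper colouring, with N colours, of the
-- Hamming graph on [n]^d.  That graph has degree d (n - 1) < N, so the colouring
-- extends greedily to a total one, which is a linjection.
module Submission where

open import Defs
open import Data.Bool using (true)
open import Data.Empty using (⊥-elim)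
open import Data.Fin using (Fin; zero; suc; splitAt; _↑ˡ_; _↑ʳ_; combine; punchIn; punchOut; quotient; remQuot)
import Data.Fin.Properties as Fin
open import Data.Fin.Subset using (Subset; inside; outside)
import Data.Fin.Subset as Sub
import Data.Fin.Subset.Properties as Sub
open import Data.List using (List; []; _∷_; length; map; allFin; cartesianProductWith)
import Data.List.Properties as List
open import Data.List.Membership.Propositional using (_∈_; lose)
import Data.List.Membership.Propositional.Properties as List∈
import Data.List.Relation.Unary.All as All
open import Data.List.Relation.Unary.AllPairs using ([]; _∷_)
open import Data.List.Relation.Unary.Any using (Any; here; there; index; any?; _─_)
open import Data.List.Relation.Unary.Unique.Propositional using (Unique)
import Data.List.Relation.Unary.Unique.Propositional.Properties as Unique
open import Data.Maybe using (Maybe; just; nothing)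
import Data.Maybe.Properties as Maybe
open import Data.Nat using (ℕ; zero; suc; _+_; _*_; _∸_; _≤_; _<_; _>_; z≤n; s≤s; s≤s⁻¹)
import Data.Nat.Properties as ℕ
open import Data.Product using (∃; ∃!; ∃₂; _×_; _,_; proj₁; proj₂)
open import Data.Sum using (inj₁; inj₂)
open import Data.Vec using (Vec; []; _∷_; lookup; tabulate; _[_]≔_)
import Data.Vec as Vec
import Data.Vec.Properties as Vec
open import Function using (_∘_; id)
open import Function.Bundles using (mk⇔; Equivalence)
open import Relation.Binary.PropositionalEquality using (_≡_; _≢_; _≗_; refl; sym; trans; cong; cong₂; subst)
open import Relation.Nullary using (¬_; Dec; yes; no; does; ¬?; _×-dec_)
open import Relation.Nullary.Decidable using (dec-true; decidable-stable)
open import Relation.Unary using (Decidable)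

open Finite ⦃ ... ⦄

-- Comparing cardinalities through injective relations, and bounding maxima.

does⁻ : ∀ {P : Set} (P? : Dec P) → does P? ≡ true → P
does⁻ (yes p) _ = p

Any-─ : ∀ {A : Set} {P Q : A → Set} {xs} → (∀ {x} → P x → ¬ Q x) →
        (p : Any P xs) → Any Q xs → Any Q (xs ─ p)
Any-─ ¬pq (here px)  (here qx)  = ⊥-elim (¬pq px qx)
Any-─ ¬pq (here px)  (there q)  = q
Any-─ ¬pq (there p)  (here qx)  = here qx
Any-─ ¬pq (there p)  (there q)  = there (Any-─ ¬pq p q)

-- Induction on `xs`: the partner of the head is deleted from `ys`. By injectivity it is a partner
-- of no later entry, so every later entry keeps its partner. A relation rather than a function lets
-- partners come from bare existence statements.
length-≤ : ∀ {A B : Set} {xs : List A} {ys : List B} (R : A → B → Set) →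
           (∀ {x x′ y} → R x y → R x′ y → x ≡ x′) → Unique xs →
           (∀ {x} → x ∈ xs → Any (R x) ys) → length xs ≤ length ys
length-≤ {xs = []}              R inj []         image = z≤n
length-≤ {xs = x ∷ xs} {ys = ys} R inj (x∉ ∷ xs!) image =
  subst (suc (length xs) ≤_) (sym (List.length-removeAt′ ys (index p)))
    (s≤s (length-≤ R inj xs! λ x′∈ →
      Any-─ (λ r r′ → All.lookup x∉ x′∈ (inj r r′)) p (image (there x′∈))))
  where
  p : Any (R x) ys
  p = image (here refl)

card-≤ : ∀ {A B : Set} ⦃ _ : Finite A ⦄ ⦃ _ : Finite B ⦄ {S : SetOf A} {T : SetOf B}
         (R : A → B → Set) → (∀ {x x′ y} → R x y → R x′ y → x ≡ x′) →
         (∀ x → x ∈ˢ S → ∃ λ y → y ∈ˢ T × R x y) → card S ≤ card T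
card-≤ {S = S} {T} R inj image = length-≤ R inj (Unique.filter⁺ (_∈ˢ? S) unique) λ x∈ →
  let y , y∈T , r = image _ (proj₂ (List∈.∈-filter⁻ (_∈ˢ? S) {xs = elements} x∈)) in
  lose (List∈.∈-filter⁺ (_∈ˢ? T) (complete y) y∈T) r

card-cong : ∀ {A : Set} ⦃ _ : Finite A ⦄ {S S′ : SetOf A} → S ≗ S′ → card S ≡ card S′
card-cong eq = ℕ.≤-antisym (mono eq) (mono (sym ∘ eq))
  where
  mono : ∀ {A : Set} ⦃ _ : Finite A ⦄ {S S′ : SetOf A} → S ≗ S′ → card S ≤ card S′
  mono eq = card-≤ _≡_ (λ p q → trans p (sym q)) λ x x∈ → x , trans (sym (eq x)) x∈ , refl

maximum-least : ∀ {A : Set} ⦃ _ : Finite A ⦄ {g : SetOf A → ℕ} {P : SetOf A → Set} (P? : Decidable P) {m} →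
                (∀ S → P S → g S ≤ m) → maximum g P P? ≤ m
maximum-least {g = g} {P} P? bound with maximum-attained g P P?
-- The default value 0 of `maximum` lies below every bound.
... | inj₁ eq            = subst (_≤ _) (sym eq) z≤n
... | inj₂ (S , pS , eq) = subst (_≤ _) (sym eq) (bound S pS)

maximum-cong : ∀ {A : Set} ⦃ _ : Finite A ⦄ {g : SetOf A → ℕ} {P Q : SetOf A → Set}
               (P? : Decidable P) (Q? : Decidable Q) → Extensional P → Extensional Q →
               (∀ {S S′} → S ≗ S′ → g S ≡ g S′) →
               (∀ {S} → P S → Q S) → (∀ {S} → Q S → P S) → maximum g P P? ≡ maximum g Q Q?
maximum-cong {g = g} {P} {Q} P? Q? P-ext Q-ext g-ext P⇒Q Q⇒P = ℕ.≤-antisym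
  (maximum-least P? λ S pS → maximum-upper g Q Q? Q-ext g-ext S (P⇒Q pS))
  (maximum-least Q? λ S qS → maximum-upper g P P? P-ext g-ext S (Q⇒P qS))

-- Counting in subsets of `Fin n`, by passing to duplicate-free lists.

members : ∀ {n} → Subset n → List (Fin n)
members []            = []
members (inside ∷ p)  = zero ∷ map suc (members p)
members (outside ∷ p) = map suc (members p)

length-members : ∀ {n} (p : Subset n) → length (members p) ≡ Sub.∣ p ∣
length-members []            = refl
length-members (inside ∷ p)  = cong suc (trans (List.length-map suc (members p)) (length-members p))
length-members (outside ∷ p) = trans (List.length-map suc (members p)) (length-members p)

members-unique : ∀ {n} (p : Subset n) → Unique (members p)
members-unique []            = []
members-unique (inside ∷ p)  =
  All.tabulate (λ y∈ 0≡y → let _ , _ , eq = List∈.∈-map⁻ suc y∈ in Fin.0≢1+n (trans 0≡y eq)) ∷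
  Unique.map⁺ Fin.suc-injective (members-unique p)
members-unique (outside ∷ p) = Unique.map⁺ Fin.suc-injective (members-unique p)

∈-members⁺ : ∀ {n x} {p : Subset n} → x Sub.∈ p → x ∈ members p
∈-members⁺ Vec.here                          = here refl
∈-members⁺ {p = inside ∷ p}  (Vec.there x∈) = there (List∈.∈-map⁺ suc (∈-members⁺ x∈))
∈-members⁺ {p = outside ∷ p} (Vec.there x∈) = List∈.∈-map⁺ suc (∈-members⁺ x∈)

∈-members⁻ : ∀ {n x} (p : Subset n) → x ∈ members p → x Sub.∈ p
∈-members⁻ (inside ∷ p)  (here refl) = Vec.here
∈-members⁻ (inside ∷ p)  (there x∈)  with _ , y∈ , refl ← List∈.∈-map⁻ suc x∈ = Vec.there (∈-members⁻ p y∈)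
∈-members⁻ (outside ∷ p) x∈          with _ , y∈ , refl ← List∈.∈-map⁻ suc x∈ = Vec.there (∈-members⁻ p y∈)

∣p∣≤∣q∣ : ∀ {m n} {p : Subset m} {q : Subset n} (R : Fin m → Fin n → Set) →
          (∀ {x x′ y} → R x y → R x′ y → x ≡ x′) →
          (∀ {x} → x Sub.∈ p → ∃ λ y → y Sub.∈ q × R x y) → Sub.∣ p ∣ ≤ Sub.∣ q ∣
∣p∣≤∣q∣ {p = p} {q} R inj image =
  subst (_≤ _) (length-members p) (subst (_ ≤_) (length-members q)
    (length-≤ R inj (members-unique p) λ x∈ →
      let y , y∈ , r = image (∈-members⁻ p x∈) in lose (∈-members⁺ y∈) r))

injection⇒≤∣p∣ : ∀ {m n} {p : Subset n} (g : Fin m → Fin n) →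
                 (∀ {i j} → g i ≡ g j → i ≡ j) → (∀ i → g i Sub.∈ p) → m ≤ Sub.∣ p ∣
injection⇒≤∣p∣ {m} {p = p} g inj g∈ = subst (_≤ Sub.∣ p ∣) (Sub.∣⊤∣≡n m)
  (∣p∣≤∣q∣ {p = Sub.⊤} (λ i x → g i ≡ x) (λ r r′ → inj (trans r (sym r′))) λ {i} _ → g i , g∈ i , refl)

injection⇒∣p∣≤ : ∀ {m n} {p : Subset n} (R : Fin n → Fin m → Set) →
                 (∀ {x y i} → x Sub.∈ p → y Sub.∈ p → R x i → R y i → x ≡ y) →
                 (∀ {x} → x Sub.∈ p → ∃ (R x)) → Sub.∣ p ∣ ≤ m
injection⇒∣p∣≤ {m} {p = p} R inj total = subst (Sub.∣ p ∣ ≤_) (Sub.∣⊤∣≡n m)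
  -- Injectivity is only given on `p`, so membership is built into the relation.
  (∣p∣≤∣q∣ (λ x i → x Sub.∈ p × R x i) (λ (x∈ , r) (y∈ , r′) → inj x∈ y∈ r r′) λ x∈ →
    let i , r = total x∈ in i , Sub.∈⊤ , x∈ , r)

∣p∣≤1+∣p-x∣ : ∀ {n} (p : Subset n) x → Sub.∣ p ∣ ≤ suc Sub.∣ p Sub.- x ∣
∣p∣≤1+∣p-x∣ (inside ∷ p)  zero    = ℕ.≤-reflexive (cong (suc ∘ Sub.∣_∣) (sym (Sub.p─⊥≡p p)))
∣p∣≤1+∣p-x∣ (outside ∷ p) zero    =
  ℕ.m≤n⇒m≤1+n (ℕ.≤-reflexive (cong Sub.∣_∣ (sym (Sub.p─⊥≡p p))))
∣p∣≤1+∣p-x∣ (inside ∷ p)  (suc x) = s≤s (∣p∣≤1+∣p-x∣ p x)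
∣p∣≤1+∣p-x∣ (outside ∷ p) (suc x) = ∣p∣≤1+∣p-x∣ p x

x∈p⇒1+∣p-x∣≡∣p∣ : ∀ {n} {p : Subset n} {x} → x Sub.∈ p → suc Sub.∣ p Sub.- x ∣ ≡ Sub.∣ p ∣
x∈p⇒1+∣p-x∣≡∣p∣ {p = p} {x} x∈ = ℕ.≤-antisym (Sub.x∈p⇒∣p-x∣<∣p∣ x∈) (∣p∣≤1+∣p-x∣ p x)

-- If `x` were `y`, removing it a second time would shrink the set strictly, whereas removal is
-- idempotent.
x∈p-y⇒x≢y : ∀ {n} (p : Subset n) {x y} → x Sub.∈ p Sub.- y → x ≢ y
x∈p-y⇒x≢y p {x} x∈ refl =
  ℕ.<-irrefl (cong Sub.∣_∣ (Sub.p─q─q≡p─q p Sub.⁅ x ⁆)) (Sub.x∈p⇒∣p-x∣<∣p∣ x∈)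

0<∣p∣⇒Nonempty : ∀ {n} (p : Subset n) → 0 < Sub.∣ p ∣ → Sub.Nonempty p
0<∣p∣⇒Nonempty {n} p 0<p with Sub.nonempty? p
... | yes ne = ne
... | no ¬ne = ⊥-elim (ℕ.<-irrefl (sym (Sub.∣⊥∣≡0 n))
                 (subst (λ q → 0 < Sub.∣ q ∣) (Sub.Empty-unique ¬ne) 0<p))

p⊆q∧∣p∣≡∣q∣⇒p≡q : ∀ {n} {p q : Subset n} → p Sub.⊆ q → Sub.∣ p ∣ ≡ Sub.∣ q ∣ → p ≡ q
p⊆q∧∣p∣≡∣q∣⇒p≡q {p = p} p⊆q eq = Sub.⊆-antisym p⊆q λ {x} x∈q →
  decidable-stable (x Sub.∈? p) λ x∉p → ℕ.<-irrefl eq (Sub.p⊂q⇒∣p∣<∣q∣ (p⊆q , x , x∈q , x∉p))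

⟪_⟫ : ∀ {n} {P : Fin n → Set} → Decidable P → Subset n
⟪ P? ⟫ = tabulate (does ∘ P?)

∈⟪⟫⁺ : ∀ {n} {P : Fin n → Set} (P? : Decidable P) {x} → P x → x Sub.∈ ⟪ P? ⟫
∈⟪⟫⁺ P? {x} px = Vec.lookup⇒[]= x _ (trans (Vec.lookup∘tabulate (does ∘ P?) x) (dec-true (P? x) px))

∈⟪⟫⁻ : ∀ {n} {P : Fin n → Set} (P? : Decidable P) {x} → x Sub.∈ ⟪ P? ⟫ → P x
∈⟪⟫⁻ P? {x} x∈ =
  does⁻ (P? x) (trans (sym (Vec.lookup∘tabulate (does ∘ P?) x)) (Vec.[]=⇒lookup x∈))

⟦_⟧ : ∀ {A : Set} {P : A → Set} → Decidable P → SetOf A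
⟦ P? ⟧ = does ∘ P?

∈⟦⟧⁺ : ∀ {A : Set} {P : A → Set} (P? : Decidable P) {x} → P x → x ∈ˢ ⟦ P? ⟧
∈⟦⟧⁺ P? {x} = dec-true (P? x)

∈⟦⟧⁻ : ∀ {A : Set} {P : A → Set} (P? : Decidable P) {x} → x ∈ˢ ⟦ P? ⟧ → P x
∈⟦⟧⁻ P? {x} = does⁻ (P? x)

-- Greedy extension of partial proper colourings.

module Colouring {V : Set} ⦃ _ : Finite V ⦄ {N : ℕ} {Adj : V → V → Set}
  (adj-sym : ∀ {x y} → Adj x y → Adj y x) (adj-irrefl : ∀ {x} → ¬ Adj x x)
  (nbrs : V → List V) (adj⇒∈nbrs : ∀ {x y} → Adj x y → y ∈ nbrs x)
  (nbrs-few : ∀ x → length (nbrs x) < N) where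

  Proper : (V → Maybe (Fin N)) → Set
  Proper c = ∀ {x y a} → Adj x y → c x ≡ just a → c y ≢ just a

  infix 4 _⊑_

  _⊑_ : (V → Maybe (Fin N)) → (V → Maybe (Fin N)) → Set
  c ⊑ c′ = ∀ {x a} → c x ≡ just a → c′ x ≡ just a

  -- Pigeonhole: if every colour occurred in `nbrs x`, sending each colour to an entry that carries
  -- it would inject `N` colours into a list shorter than `N`.
  freeColour : ∀ (c : V → Maybe (Fin N)) x → ∃ λ a → ∀ {y} → Adj x y → c y ≢ just a
  freeColour c x =
    let a , a∉ = Fin.¬∀⟶∃¬ N Used used? not-all in
    a , λ xy cy → a∉ (lose (adj⇒∈nbrs xy) cy)
    where
    Used : Fin N → Set
    Used a = Any (λ y → c y ≡ just a) (nbrs x)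

    used? : Decidable Used
    used? a = any? (λ y → Maybe.≡-dec Fin._≟_ (c y) (just a)) (nbrs x)

    not-all : ¬ (∀ a → Used a)
    not-all used = ℕ.<⇒≱ (nbrs-few x)
      (subst (_≤ length (nbrs x)) (List.length-tabulate id)
        (length-≤ (λ a y → c y ≡ just a) (λ p q → Maybe.just-injective (trans (sym p) q))
          (Unique.allFin⁺ N) (λ {a} _ → used a)))

  assign : V → Fin N → (V → Maybe (Fin N)) → V → Maybe (Fin N)
  assign x a c y with y ≟ x
  ... | yes _ = just a
  ... | no  _ = c y

  assign-proper : ∀ {c x a} → Proper c → (∀ {y} → Adj x y → c y ≢ just a) → Proper (assign x a c)
  assign-proper {x = x} c-proper free {y} {z} yz cy cz with y ≟ x | z ≟ x
  assign-proper c-proper free yz cy   cz   | yes refl | yes refl = adj-irrefl yz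
  assign-proper c-proper free yz refl cz   | yes refl | no _     = free yz cz
  assign-proper c-proper free yz cy   refl | no _     | yes refl = free (adj-sym yz) cy
  assign-proper c-proper free yz cy   cz   | no _     | no _     = c-proper yz cy cz

  assign-self : ∀ {c} x a → assign x a c x ≡ just a
  assign-self x a with x ≟ x
  ... | yes _  = refl
  ... | no x≢x = ⊥-elim (x≢x refl)

  assign-extends : ∀ {c} x a → c x ≡ nothing → c ⊑ assign x a c
  assign-extends x a cx {y} cy with y ≟ x
  ... | no _ = cy
  ... | yes refl with () ← trans (sym cx) cy

  colour-vertex : ∀ {c} → Proper c → ∀ x → ∃ λ c′ → Proper c′ × c ⊑ c′ × ∃ λ a → c′ x ≡ just a
  colour-vertex {c} c-proper x with c x in cx
  ... | just a  = c , c-proper , id , a , cx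
  ... | nothing =
    let a , free = freeColour c x in
    assign x a c , assign-proper c-proper free , assign-extends x a cx , a , assign-self x a

  -- The tail is coloured first, then the head. Each stage extends the previous one, so vertices
  -- already coloured stay coloured.
  colour-list : ∀ {c} → Proper c → ∀ xs →
                ∃ λ c′ → Proper c′ × c ⊑ c′ × (∀ {x} → x ∈ xs → ∃ λ a → c′ x ≡ just a)
  colour-list {c} c-proper []       = c , c-proper , id , λ ()
  colour-list {c} c-proper (x ∷ xs) =
    let c₁ , c₁-proper , c⊑c₁  , coloured    = colour-list c-proper xs
        c₂ , c₂-proper , c₁⊑c₂ , x-coloured = colour-vertex c₁-proper x
    in c₂ , c₂-proper , (λ cx → c₁⊑c₂ (c⊑c₁ cx)) ,
       λ { (here refl) → x-coloured ; (there x∈) → let a , eq = coloured x∈ in a , c₁⊑c₂ eq }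

  extend-colouring : ∀ {c} → Proper c → ∃ λ (c′ : V → Fin N) →
                     (∀ {x y} → Adj x y → c′ x ≢ c′ y) × (∀ {x a} → c x ≡ just a → c′ x ≡ a)
  extend-colouring c-proper =
    let c′ , c′-proper , c⊑c′ , coloured = colour-list c-proper elements
        total x = coloured (complete x)
    in (λ x → proj₁ (total x)) ,
       (λ {x} {y} xy eq → c′-proper xy (proj₂ (total x)) (trans (proj₂ (total y)) (cong just (sym eq)))) ,
       λ {x} cx → Maybe.just-injective (trans (sym (proj₂ (total x))) (c⊑c′ cx))

-- The Hamming graph and its degree.

lookup-injective : ∀ {A : Set} {n} {xs ys : Vec A n} → (∀ i → lookup xs i ≡ lookup ys i) → xs ≡ ys
lookup-injective {xs = xs} {ys} eq =
  trans (sym (Vec.tabulate∘lookup xs)) (trans (Vec.tabulate-cong eq) (Vec.tabulate∘lookup ys))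

module Hamming (d n : ℕ) where

  -- Differing in exactly one coordinate. The side length is `suc n`, so that `n` counts the
  -- alternatives in one coordinate.
  Adj : Vec (Fin (suc n)) d → Vec (Fin (suc n)) d → Set
  Adj xs ys = xs ≢ ys × ∃ λ i → ∀ j → j ≢ i → lookup xs j ≡ lookup ys j

  adj-sym : ∀ {xs ys} → Adj xs ys → Adj ys xs
  adj-sym (xs≢ys , i , eq) = xs≢ys ∘ sym , i , λ j j≢i → sym (eq j j≢i)

  adj-irrefl : ∀ {xs} → ¬ Adj xs xs
  adj-irrefl (xs≢xs , _) = xs≢xs refl

  -- `punchIn (lookup xs i)` runs through the `n` values other than the present one, so the list has
  -- exactly `d * n` entries.
  nbrs : Vec (Fin (suc n)) d → List (Vec (Fin (suc n)) d)
  nbrs xs = cartesianProductWith (λ i a → xs [ i ]≔ punchIn (lookup xs i) a) (allFin d) (allFin n)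

  length-cartesianProductWith : ∀ {A B C : Set} (f : A → B → C) xs ys →
                                length (cartesianProductWith f xs ys) ≡ length xs * length ys
  length-cartesianProductWith f []       ys = refl
  length-cartesianProductWith f (x ∷ xs) ys = trans (List.length-++ (map (f x) ys))
    (cong₂ _+_ (List.length-map (f x) ys) (length-cartesianProductWith f xs ys))

  length-nbrs : ∀ xs → length (nbrs xs) ≡ d * n
  length-nbrs xs = trans (length-cartesianProductWith _ (allFin d) (allFin n))
    (cong₂ _*_ (List.length-tabulate {n = d} id) (List.length-tabulate {n = n} id))

  adj⇒∈nbrs : ∀ {xs ys} → Adj xs ys → ys ∈ nbrs xs
  adj⇒∈nbrs {xs} {ys} (xs≢ys , i , eq) =
    subst (_∈ nbrs xs) (lookup-injective agree)
      (List∈.∈-cartesianProductWith⁺ _ (List∈.∈-allFin i) (List∈.∈-allFin (punchOut xsᵢ≢ysᵢ)))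
    where
    -- Needed for `punchOut`, which recovers the index of the new value: agreement at `i` as well
    -- would make the vectors equal.
    xsᵢ≢ysᵢ : lookup xs i ≢ lookup ys i
    xsᵢ≢ysᵢ xsᵢ≡ysᵢ = xs≢ys (lookup-injective λ j → differ j (j ≟ i))
      where
      differ : ∀ j → Dec (j ≡ i) → lookup xs j ≡ lookup ys j
      differ j (yes refl) = xsᵢ≡ysᵢ
      differ j (no j≢i)   = eq j j≢i

    agree : ∀ j → lookup (xs [ i ]≔ punchIn (lookup xs i) (punchOut xsᵢ≢ysᵢ)) j ≡ lookup ys j
    agree j with j ≟ i
    ... | yes refl = trans (Vec.lookup∘update i xs _) (Fin.punchIn-punchOut xsᵢ≢ysᵢ)
    ... | no j≢i   = trans (Vec.lookup∘update′ j≢i xs _) (eq j j≢i)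

-- Points as transversal vertex sets, and their faces.

module Correspondence (d n N : ℕ) where

  open Cube d n N
  open Hypergraph d n N

  vertex : (i : Fin (suc d)) → Fin (dimSize i) → Fin v
  vertex zero    b = b ↑ˡ (d * n)
  vertex (suc i) a = N ↑ʳ combine i a

  part-vertex : ∀ i a → part (vertex i a) ≡ i
  part-vertex zero    b rewrite Fin.splitAt-↑ˡ N b (d * n) = refl
  part-vertex (suc i) a rewrite Fin.splitAt-↑ʳ N (d * n) (combine i a) =
    cong (suc ∘ proj₁) (Fin.remQuot-combine i a)

  vertex-surjective : ∀ u → ∃₂ λ i a → vertex i a ≡ u
  vertex-surjective u with splitAt N u in eq
  ... | inj₁ b = zero , b , Fin.splitAt⁻¹-↑ˡ eq
  ... | inj₂ w = suc (quotient {d} n w) , proj₂ (remQuot {d} n w) ,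
                 trans (cong (N ↑ʳ_) (Fin.combine-remQuot {d} n w)) (Fin.splitAt⁻¹-↑ʳ {N} eq)

  vertex-injective : ∀ i {a b} → vertex i a ≡ vertex i b → a ≡ b
  vertex-injective zero    eq = Fin.↑ˡ-injective (d * n) _ _ eq
  vertex-injective (suc i) {a} {b} eq =
    Fin.combine-injectiveʳ i a i b (Fin.↑ʳ-injective N _ _ eq)

  coord-injective : ∀ {p q} → (∀ i → coord p i ≡ coord q i) → p ≡ q
  coord-injective eq = cong₂ _,_ (lookup-injective (eq ∘ suc)) (eq zero)

  sameOff-sym : ∀ {i p q} → SameOff i p q → SameOff i q p
  sameOff-sym pq j j≢i = sym (pq j j≢i)

  vertexOf : Point → Fin (suc d) → Fin v
  vertexOf p i = vertex i (coord p i)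

  part-vertexOf : ∀ p i → part (vertexOf p i) ≡ i
  part-vertexOf p i = part-vertex i (coord p i)

  vertexOf-injective : ∀ p {i j} → vertexOf p i ≡ vertexOf p j → i ≡ j
  vertexOf-injective p {i} {j} eq =
    trans (sym (part-vertexOf p i)) (trans (cong part eq) (part-vertexOf p j))

  -- Applying `part` identifies `i` with `j`, after which both coordinates belong to the same part
  -- and `vertex-injective` applies.
  vertexOf-agree : ∀ {p q i j} → vertexOf p i ≡ vertexOf q j → coord p i ≡ coord q i
  vertexOf-agree {p} {q} {i} {j} eq with trans (sym (part-vertexOf p i)) (trans (cong part eq) (part-vertexOf q j))
  ... | refl = vertex-injective i eq

  -- Abstract here and below: otherwise with-abstraction normalises the decision
  -- procedures behind these sets, which is infeasible.
  abstract

    toSet : Point → VertexSet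
    toSet p = ⟪ (λ u → ∃? λ i → vertexOf p i ≟ u) ⟫

    ∈toSet⁺ : ∀ p {u} → (∃ λ i → vertexOf p i ≡ u) → u Sub.∈ toSet p
    ∈toSet⁺ p = ∈⟪⟫⁺ (λ u → ∃? λ i → vertexOf p i ≟ u)

    ∈toSet⁻ : ∀ p {u} → u Sub.∈ toSet p → ∃ λ i → vertexOf p i ≡ u
    ∈toSet⁻ p = ∈⟪⟫⁻ (λ u → ∃? λ i → vertexOf p i ≟ u)

    face : Fin (suc d) → Point → VertexSet
    face i p = ⟪ (λ u → ∃? λ j → ¬? (j ≟ i) ×-dec (vertexOf p j ≟ u)) ⟫

    ∈face⁺ : ∀ i p {u} → (∃ λ j → j ≢ i × vertexOf p j ≡ u) → u Sub.∈ face i p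
    ∈face⁺ i p = ∈⟪⟫⁺ (λ u → ∃? λ j → ¬? (j ≟ i) ×-dec (vertexOf p j ≟ u))

    ∈face⁻ : ∀ i p {u} → u Sub.∈ face i p → ∃ λ j → j ≢ i × vertexOf p j ≡ u
    ∈face⁻ i p = ∈⟪⟫⁻ (λ u → ∃? λ j → ¬? (j ≟ i) ×-dec (vertexOf p j ≟ u))

  vertexOf∈toSet : ∀ p i → vertexOf p i Sub.∈ toSet p
  vertexOf∈toSet p i = ∈toSet⁺ p (i , refl)

  vertexOf∈face : ∀ p {i j} → j ≢ i → vertexOf p j Sub.∈ face i p
  vertexOf∈face p {i} {j} j≢i = ∈face⁺ i p (j , j≢i , refl)

  face⊆toSet : ∀ i p → face i p Sub.⊆ toSet p
  face⊆toSet i p u∈ with j , _ , refl ← ∈face⁻ i p u∈ = vertexOf∈toSet p j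

  coord-of-toSet : ∀ {p q i} → vertexOf p i Sub.∈ toSet q → coord p i ≡ coord q i
  coord-of-toSet {p} {q} u∈ =
    let j , eq = ∈toSet⁻ q u∈ in vertexOf-agree {p} {q} {j = j} (sym eq)

  toSet-injective : ∀ {p q} → toSet p ≡ toSet q → p ≡ q
  toSet-injective {p} {q} eq = coord-injective λ i →
    coord-of-toSet {p} {q} (subst (vertexOf p i Sub.∈_) eq (vertexOf∈toSet p i))

  ∣toSet∣ : ∀ p → Sub.∣ toSet p ∣ ≡ suc d
  ∣toSet∣ p = ℕ.≤-antisym
    (injection⇒∣p∣≤ (λ u i → vertexOf p i ≡ u) (λ _ _ eq eq′ → trans (sym eq) eq′) (∈toSet⁻ p))
    (injection⇒≤∣p∣ (vertexOf p) (vertexOf-injective p) (vertexOf∈toSet p))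

  ∣face∣ : ∀ i p → Sub.∣ face i p ∣ ≡ d
  ∣face∣ i p = ℕ.≤-antisym
    -- The `d` indices other than `i` are enumerated by `punchIn i`, with `punchOut` going back.
    (injection⇒∣p∣≤ (λ u j → vertexOf p (punchIn i j) ≡ u) (λ _ _ eq eq′ → trans (sym eq) eq′) λ u∈ →
      let j , j≢i , eq = ∈face⁻ i p u∈ in
      punchOut (j≢i ∘ sym) , trans (cong (vertexOf p) (Fin.punchIn-punchOut (j≢i ∘ sym))) eq)
    (injection⇒≤∣p∣ (vertexOf p ∘ punchIn i)
      (λ {j} {k} eq → Fin.punchIn-injective i j k (vertexOf-injective p eq))
      (λ j → vertexOf∈face p (Fin.punchInᵢ≢i i j)))

  face⊆face : ∀ {i p q} → SameOff i p q → face i p Sub.⊆ face i q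
  face⊆face {i} {p} {q} pq u∈ with j , j≢i , refl ← ∈face⁻ i p u∈ =
    subst (λ a → vertex j a Sub.∈ face i q) (sym (pq j j≢i)) (vertexOf∈face q j≢i)

  -- A face depends only on the line in direction `i`; hence any condition on `face i p` defines a
  -- cylinder in dimension `i`.
  face-cong : ∀ {i p q} → SameOff i p q → face i p ≡ face i q
  face-cong pq = Sub.⊆-antisym (face⊆face pq) (face⊆face (sameOff-sym pq))

  -- For each `j` other than `i`, the face contains the vertex of `p` in part `j`, and `q` has only
  -- one vertex in that part.
  face⊆toSet⇒sameOff : ∀ {i p q} → face i p Sub.⊆ toSet q → SameOff i p q
  face⊆toSet⇒sameOff {i} {p} {q} ⊆q j j≢i = coord-of-toSet {p} {q} (⊆q (vertexOf∈face p j≢i))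

  -- The `suc d` vertices of `p` cannot all lie in a set of size `d`. If the one in part `i` is
  -- missing, `e` lies in `face i p`, which has the same size.
  subset-is-face : ∀ {e} p → e Sub.⊆ toSet p → Sub.∣ e ∣ ≡ d → ∃ λ i → e ≡ face i p
  subset-is-face {e} p e⊆ ∣e∣ =
    let i , i∉e = Fin.¬∀⟶∃¬ (suc d) (λ i → vertexOf p i Sub.∈ e) (λ i → vertexOf p i Sub.∈? e) not-all
    in i , p⊆q∧∣p∣≡∣q∣⇒p≡q (e⊆face i i∉e) (trans ∣e∣ (sym (∣face∣ i p)))
    where
    not-all : ¬ (∀ i → vertexOf p i Sub.∈ e)
    not-all all∈ = ℕ.<-irrefl (sym ∣e∣) (injection⇒≤∣p∣ (vertexOf p) (vertexOf-injective p) all∈)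

    e⊆face : ∀ i → ¬ vertexOf p i Sub.∈ e → e Sub.⊆ face i p
    e⊆face i i∉e u∈e with j , refl ← ∈toSet⁻ p (e⊆ u∈e) =
      vertexOf∈face p {i} {j} λ { refl → i∉e u∈e }

  -- Cliques are transversal.

  PartInjective : VertexSet → Set
  PartInjective e = ∀ u w → u Sub.∈ e → w Sub.∈ e → part u ≡ part w → u ≡ w

  toSet-partInjective : ∀ p → PartInjective (toSet p)
  toSet-partInjective p u w u∈ w∈ eq
    with i , refl ← ∈toSet⁻ p u∈ | j , refl ← ∈toSet⁻ p w∈ =
    cong (vertexOf p) (trans (sym (part-vertexOf p i)) (trans eq (part-vertexOf p j)))

  -- If some part were missed, `part` would inject the `suc d` vertices of `C` into the `d`
  -- remaining parts. So every part is hit, and one vertex picked from each gives the point.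
  transversal : ∀ C → Sub.∣ C ∣ ≡ suc d → PartInjective C → ∃ λ p → toSet p ≡ C
  transversal C ∣C∣ C-inj = p , p⊆q∧∣p∣≡∣q∣⇒p≡q p⊆C (trans (∣toSet∣ p) (sym ∣C∣))
    where
    no-missing-part : ∀ i → ¬ (∀ a → ¬ vertex i a Sub.∈ C)
    no-missing-part i missing = ℕ.<-irrefl ∣C∣ (s≤s
      (injection⇒∣p∣≤ (λ u j → part u ≡ punchIn i j)
        (λ u∈ w∈ eq eq′ → C-inj _ _ u∈ w∈ (trans eq (sym eq′)))
        (λ u∈ → punchOut (i≢part u∈) , sym (Fin.punchIn-punchOut (i≢part u∈)))))
      where
      i≢part : ∀ {u} → u Sub.∈ C → i ≢ part u
      i≢part {u} u∈ i≡ with j , a , refl ← vertex-surjective u with refl ← trans i≡ (part-vertex j a) =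
        missing a u∈

    pick : ∀ i → ∃ λ a → vertex i a Sub.∈ C
    pick i = decidable-stable (∃? λ a → vertex i a Sub.∈? C) λ none →
      no-missing-part i λ a a∈ → none (a , a∈)

    p : Point
    p = tabulate (λ i → proj₁ (pick (suc i))) , proj₁ (pick zero)

    coord-p : ∀ i → coord p i ≡ proj₁ (pick i)
    coord-p zero    = refl
    coord-p (suc i) = Vec.lookup∘tabulate _ i

    p⊆C : toSet p Sub.⊆ C
    p⊆C u∈ with i , refl ← ∈toSet⁻ p u∈ =
      subst (λ a → vertex i a Sub.∈ C) (sym (coord-p i)) (proj₂ (pick i))

  -- As d + 1 ≥ 3, any two vertices of a clique lie in a common edge, so no
  -- part is hit twice.
  clique-is-point : 2 ≤ d → ∀ {E C} → (∀ e → E e → PartInjective e) → IsClique E C → ∃ λ p → toSet p ≡ C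
  clique-is-point 2≤d {E} {C} E-inj (∣C∣ , edges) = transversal C ∣C∣ C-inj
    where
    C-inj : PartInjective C
    C-inj u w u∈ w∈ same =
      -- Removing `u` and `w` costs at most two of at least three vertices, so a third vertex `z` is
      -- left; `C` without `z` is then an edge containing both.
      let z , z∈ = 0<∣p∣⇒Nonempty (C Sub.- u Sub.- w) (s≤s⁻¹ (s≤s⁻¹ 3≤))
          z∈C-u = Sub.p─q⊆p (C Sub.- u) Sub.⁅ w ⁆ z∈
          z∈C   = Sub.p─q⊆p C Sub.⁅ u ⁆ z∈C-u
          e     = C Sub.- z
      in E-inj e
           (edges e (Sub.p─q⊆p C Sub.⁅ z ⁆) (ℕ.suc-injective (trans (x∈p⇒1+∣p-x∣≡∣p∣ z∈C) ∣C∣)))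
           u w
           (Sub.x∈p∧x≢y⇒x∈p-y u∈ (x∈p-y⇒x≢y C z∈C-u ∘ sym))
           (Sub.x∈p∧x≢y⇒x∈p-y w∈ (x∈p-y⇒x≢y (C Sub.- u) z∈ ∘ sym))
           same
      where
      3≤ : 3 ≤ suc (suc Sub.∣ C Sub.- u Sub.- w ∣)
      3≤ = ℕ.≤-trans (s≤s 2≤d) (ℕ.≤-trans (ℕ.≤-reflexive (sym ∣C∣))
             (ℕ.≤-trans (∣p∣≤1+∣p-x∣ C u) (s≤s (∣p∣≤1+∣p-x∣ (C Sub.- u) w))))

  isClique-mono : ∀ {E E′ C} → (∀ {e} → E e → E′ e) → IsClique E C → IsClique E′ C
  isClique-mono E⇒E′ (∣C∣ , edges) = ∣C∣ , λ e e⊆ ∣e∣ → E⇒E′ (edges e e⊆ ∣e∣)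

  -- Invariance under pointwise equality, as the list `subsets` represents sets only up to it.

  linjection-ext : Extensional IsLinjection
  linjection-ext eq (linjection value sparse) = linjection
    (λ xs → let b , fb , unique-b = value xs in
            b , trans (sym (eq (xs , b))) fb , λ fb′ → unique-b (trans (eq _) fb′))
    (λ i p x y xp yp fx fy → sparse i p x y xp yp (trans (eq x) fx) (trans (eq y) fy))

  cylinderIntersection-ext : Extensional IsCylinderIntersection
  cylinderIntersection-ext eq (T , cyl , int) = T , cyl , λ x →
    mk⇔ (Equivalence.to (int x) ∘ trans (eq x)) (trans (sym (eq x)) ∘ Equivalence.from (int x))

  cylinderIntersection⊆-ext : ∀ f → Extensional (λ S → IsCylinderIntersection S × S ⊆ˢ f)
  cylinderIntersection⊆-ext f eq (S-int , S⊆f) =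
    cylinderIntersection-ext eq S-int , λ x → S⊆f x ∘ trans (eq x)

  α-cong : ∀ {f f′} → f ≗ f′ → α-of f ≡ α-of f′
  α-cong {f} {f′} eq = maximum-cong
    (λ S → IsCylinderIntersection? S ×-dec (S ⊆ˢ? f)) (λ S → IsCylinderIntersection? S ×-dec (S ⊆ˢ? f′))
    (cylinderIntersection⊆-ext f) (cylinderIntersection⊆-ext f′) card-cong
    (λ (S-int , S⊆) → S-int , λ x → trans (sym (eq x)) ∘ S⊆ x)
    (λ (S-int , S⊆) → S-int , λ x → trans (eq x) ∘ S⊆ x)

  partiteUniform-ext : Extensional (λ H → IsPartite H × IsUniform H)
  partiteUniform-ext eq (partite , uniform) =
    (λ e → partite e ∘ trans (eq e)) , (λ e → uniform e ∘ trans (eq e))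

  goodFamily-resp : ∀ {H H′ K K′} → H ≗ H′ → K ≗ K′ → IsGoodFamily H K → IsGoodFamily H′ K′
  goodFamily-resp {H} {H′} {K} {K′} H≗H′ K≗K′ (goodFamily cliques disjoint closed) = goodFamily
    (λ C → isClique-mono (λ {e} → trans (sym (H≗H′ e))) ∘ cliques C ∘ trans (K≗K′ C))
    (λ C D C∈ D∈ e → disjoint C D (trans (K≗K′ C) C∈) (trans (K≗K′ D) D∈) e ∘ trans (H≗H′ e))
    (λ C → trans (sym (K≗K′ C)) ∘ closed C ∘ isClique-mono {EdgeOfSome H′ K′} {EdgeOfSome H K}
      λ {e} (D , D∈ , e∈ , e⊆) → D , trans (K≗K′ D) D∈ , trans (H≗H′ e) e∈ , e⊆)

  goodFamily-ext : ∀ H → Extensional (IsGoodFamily H)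
  goodFamily-ext H = goodFamily-resp λ _ → refl

  ᾱ-cong : ∀ {H H′} → H ≗ H′ → ᾱ-of H ≡ ᾱ-of H′
  ᾱ-cong {H} {H′} eq = maximum-cong (IsGoodFamily? H) (IsGoodFamily? H′)
    (goodFamily-ext H) (goodFamily-ext H′) card-cong
    (goodFamily-resp eq λ _ → refl) (goodFamily-resp (sym ∘ eq) λ _ → refl)

  card≤α : ∀ {f S} → IsLinjection f → IsCylinderIntersection S → S ⊆ˢ f → card S ≤ max-α
  card≤α {f} {S} f-lin S-int S⊆f = ℕ.≤-trans
    (maximum-upper card _ (λ S → IsCylinderIntersection? S ×-dec (S ⊆ˢ? f))
      (cylinderIntersection⊆-ext f) card-cong S (S-int , S⊆f))
    (maximum-upper α-of IsLinjection IsLinjection? linjection-ext α-cong f f-lin)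

  card≤ᾱ : ∀ {H K} → IsPartite H → IsUniform H → IsGoodFamily H K → card K ≤ max-ᾱ
  card≤ᾱ {H} {K} partite uniform good = ℕ.≤-trans
    (maximum-upper card (IsGoodFamily H) (IsGoodFamily? H) (goodFamily-ext H) card-cong K good)
    (maximum-upper ᾱ-of _ (λ H → IsPartite? H ×-dec IsUniform? H) partiteUniform-ext ᾱ-cong H
      (partite , uniform))

  -- What subsets of a linjection inherit, making them partial linjections. This is the counterpart
  -- of edge-disjointness of cliques.
  Sparse : SetOf Point → Set
  Sparse S = ∀ {i p q} → p ∈ˢ S → q ∈ˢ S → SameOff i p q → p ≡ q

  -- From cylinder intersections to clique families.

  module CylinderToCliques {S : SetOf Point} (S-int : IsCylinderIntersection S) (S-sparse : Sparse S) where

    abstract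

      K : SetOf VertexSet
      K = ⟦ (λ C → ∃? λ p → (p ∈ˢ? S) ×-dec (toSet p ≟ C)) ⟧

      ∈K⁺ : ∀ {C} → (∃ λ p → p ∈ˢ S × toSet p ≡ C) → C ∈ˢ K
      ∈K⁺ = ∈⟦⟧⁺ (λ C → ∃? λ p → (p ∈ˢ? S) ×-dec (toSet p ≟ C))

      ∈K⁻ : ∀ {C} → C ∈ˢ K → ∃ λ p → p ∈ˢ S × toSet p ≡ C
      ∈K⁻ = ∈⟦⟧⁻ (λ C → ∃? λ p → (p ∈ˢ? S) ×-dec (toSet p ≟ C))

      -- By `subset-is-face` these are the faces of points of `S`; phrased with subsets, each point
      -- of `S` is a clique at once.
      H : SetOf VertexSet
      H = ⟦ (λ e → (Sub.∣ e ∣ ℕ.≟ d) ×-dec ∃? λ p → (p ∈ˢ? S) ×-dec (e Sub.⊆? toSet p)) ⟧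

      ∈H⁺ : ∀ {e} → (Sub.∣ e ∣ ≡ d × ∃ λ p → p ∈ˢ S × e Sub.⊆ toSet p) → e ∈ˢ H
      ∈H⁺ = ∈⟦⟧⁺ (λ e → (Sub.∣ e ∣ ℕ.≟ d) ×-dec ∃? λ p → (p ∈ˢ? S) ×-dec (e Sub.⊆? toSet p))

      ∈H⁻ : ∀ {e} → e ∈ˢ H → Sub.∣ e ∣ ≡ d × ∃ λ p → p ∈ˢ S × e Sub.⊆ toSet p
      ∈H⁻ = ∈⟦⟧⁻ (λ e → (Sub.∣ e ∣ ℕ.≟ d) ×-dec ∃? λ p → (p ∈ˢ? S) ×-dec (e Sub.⊆? toSet p))

    H-partite : IsPartite H
    H-partite e e∈ u w u∈ w∈ =
      let _ , p , _ , e⊆ = ∈H⁻ e∈ in toSet-partInjective p u w (e⊆ u∈) (e⊆ w∈)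

    H-uniform : IsUniform H
    H-uniform e e∈ = proj₁ (∈H⁻ e∈)

    cliques : ∀ C → C ∈ˢ K → IsClique (_∈ˢ H) C
    cliques C C∈ with p , p∈ , refl ← ∈K⁻ C∈ =
      ∣toSet∣ p , λ e e⊆ ∣e∣ → ∈H⁺ (∣e∣ , p , p∈ , e⊆)

    -- The shared edge is a face of `p` lying in `toSet q`, which puts `p` and `q` on a common line;
    -- sparseness then identifies them.
    disjoint : ∀ C D → C ∈ˢ K → D ∈ˢ K → ∀ e → e ∈ˢ H → e Sub.⊆ C → e Sub.⊆ D → C ≡ D
    disjoint C D C∈ D∈ e e∈ e⊆C e⊆D
      with p , p∈ , refl ← ∈K⁻ C∈ | q , q∈ , refl ← ∈K⁻ D∈
      with i , refl ← subset-is-face p e⊆C (H-uniform e e∈) =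
      cong toSet (S-sparse p∈ q∈ (face⊆toSet⇒sameOff {i} {p} {q} e⊆D))

    -- For each `i`, the face of `p` lies in the clique of some `q` in `S`, so `p` and `q` agree off
    -- `i`. As `q` is in the `i`-th cylinder, so is `p`.
    point∈S : ∀ p → IsClique (EdgeOfSome H K) (toSet p) → p ∈ˢ S
    point∈S p (_ , edges) =
      let T , cyl , int = S-int in
      Equivalence.from (int p) λ i →
        let D , D∈ , _ , face⊆D = edges (face i p) (face⊆toSet i p) (∣face∣ i p)
            q , q∈ , toSet≡D    = ∈K⁻ D∈
            pq                  = face⊆toSet⇒sameOff {i} {p} {q} (subst (face i p Sub.⊆_) (sym toSet≡D) face⊆D)
        in cyl i q p (sameOff-sym pq) (Equivalence.to (int q) q∈ i)

    closed : 2 ≤ d → ∀ C → IsClique (EdgeOfSome H K) C → C ∈ˢ K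
    closed 2≤d C C-clique =
      let p , eq = clique-is-point 2≤d {EdgeOfSome H K} {C} (λ e (_ , _ , e∈ , _) → H-partite e e∈) C-clique
      in ∈K⁺ (p , point∈S p (subst (IsClique (EdgeOfSome H K)) (sym eq) C-clique) , eq)

    cardS≤ᾱ : 2 ≤ d → card S ≤ max-ᾱ
    cardS≤ᾱ 2≤d = ℕ.≤-trans
      (card-≤ (λ p C → toSet p ≡ C) (λ eq eq′ → toSet-injective (trans eq (sym eq′)))
        λ p p∈ → toSet p , ∈K⁺ (p , p∈ , refl) , refl)
      (card≤ᾱ H-partite H-uniform (goodFamily cliques disjoint (closed 2≤d)))

  max-α≤max-ᾱ : 2 ≤ d → max-α ≤ max-ᾱ
  max-α≤max-ᾱ 2≤d = maximum-least IsLinjection? λ f f-lin →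
    maximum-least (λ S → IsCylinderIntersection? S ×-dec (S ⊆ˢ? f)) λ S (S-int , S⊆f) →
      CylinderToCliques.cardS≤ᾱ S-int
        (λ {i} {p} {q} p∈ q∈ pq → IsLinjection.sparse f-lin i q p q pq (λ _ _ → refl) (S⊆f p p∈) (S⊆f q q∈))
        2≤d

  -- From clique families to cylinder intersections.

  module CliquesToCylinder {H K : SetOf VertexSet} (good : IsGoodFamily H K) where

    open IsGoodFamily good

    S : SetOf Point
    S = K ∘ toSet

    abstract

      T : Fin (suc d) → SetOf Point
      T i = ⟦ (λ p → EdgeOfSome? H K (face i p)) ⟧

      ∈T⁺ : ∀ i {p} → EdgeOfSome H K (face i p) → p ∈ˢ T i
      ∈T⁺ i = ∈⟦⟧⁺ (λ p → EdgeOfSome? H K (face i p))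

      ∈T⁻ : ∀ i {p} → p ∈ˢ T i → EdgeOfSome H K (face i p)
      ∈T⁻ i = ∈⟦⟧⁻ (λ p → EdgeOfSome? H K (face i p))

    -- Faces of a clique of `K` are edges of it. Conversely, if all faces of `p` are such edges,
    -- then so are all `d`-subsets of `toSet p`, and `closed` puts it in `K`.
    S-cylinderIntersection : IsCylinderIntersection S
    S-cylinderIntersection =
      T ,
      (λ i p q pq p∈ → ∈T⁺ i
        (subst (EdgeOfSome H K) (face-cong {i} {p} {q} pq) (∈T⁻ i p∈))) ,
      (λ p → mk⇔
        (λ p∈ i → ∈T⁺ i
          (toSet p , p∈ , proj₂ (cliques _ p∈) (face i p) (face⊆toSet i p) (∣face∣ i p) , face⊆toSet i p))
        (λ p∈T → closed (toSet p) (∣toSet∣ p , λ e e⊆ ∣e∣ →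
          let i , e≡ = subset-is-face p e⊆ ∣e∣ in
          subst (EdgeOfSome H K) (sym e≡) (∈T⁻ i (p∈T i)))))

    -- Two points on a line in direction `i` share their `i`-th face, an edge of both cliques.
    S-sparse : Sparse S
    S-sparse {i} {p} {q} p∈ q∈ pq = toSet-injective (disjoint (toSet p) (toSet q) p∈ q∈ (face i p)
      (proj₂ (cliques _ p∈) (face i p) (face⊆toSet i p) (∣face∣ i p))
      (face⊆toSet i p)
      (face⊆toSet i q ∘ face⊆face {i} {p} {q} pq))

    -- `S` sees only the transversal members of `K`; by `clique-is-point` there are no others.
    cardK≤cardS : 2 ≤ d → IsPartite H → card K ≤ card S
    cardK≤cardS 2≤d partite = card-≤ (λ C p → toSet p ≡ C) (λ eq eq′ → trans (sym eq) eq′) λ C C∈ →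
      let p , eq = clique-is-point 2≤d {_∈ˢ H} {C} partite (cliques C C∈) in
      p , subst (_∈ˢ K) (sym eq) C∈ , eq

-- Extending a sparse set to a linjection.

module Extension (d m N : ℕ) (few : d * m < N) where

  open Cube d (suc m) N
  open Correspondence d (suc m) N using (Sparse; coord-injective)
  open Hamming d m
  open Colouring {N = N} (λ {xs} {ys} → adj-sym {xs} {ys}) adj-irrefl nbrs adj⇒∈nbrs
    (λ xs → subst (_< N) (sym (length-nbrs xs)) few)

  module _ {S : SetOf Point} (S-sparse : Sparse S) where

    colour : Vec (Fin (suc m)) d → Maybe (Fin N)
    colour xs with ∃? (λ b → (xs , b) ∈ˢ? S)
    ... | yes (b , _) = just b
    ... | no _        = nothing

    colour-sound : ∀ {xs b} → colour xs ≡ just b → (xs , b) ∈ˢ S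
    colour-sound {xs} eq with ∃? (λ b → (xs , b) ∈ˢ? S)
    colour-sound refl | yes (b , b∈) = b∈

    colour-complete : ∀ {xs b} → (xs , b) ∈ˢ S → colour xs ≡ just b
    colour-complete {xs} b∈ with ∃? (λ b → (xs , b) ∈ˢ? S)
    -- The search may return another value than `b`, but both points lie on one line in direction
    -- `zero`.
    ... | yes (b′ , b′∈) = cong (just ∘ proj₂)
      (S-sparse {zero} b′∈ b∈ λ { zero 0≢0 → ⊥-elim (0≢0 refl) ; (suc j) _ → refl })
    ... | no none = ⊥-elim (none (_ , b∈))

    -- Adjacent vertices with a common colour would give two points of `S` on a line in direction
    -- `suc i`, the colour being their shared coordinate `zero`.
    colour-proper : Proper colour
    colour-proper {xs} {ys} (xs≢ys , i , eq) cx cy = xs≢ys (cong proj₁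
      (S-sparse {suc i} (colour-sound {xs} cx) (colour-sound {ys} cy)
        λ { zero _ → refl ; (suc j) j≢i → eq j (j≢i ∘ cong suc) }))

    extend-to-linjection : ∃ λ f → IsLinjection f × S ⊆ˢ f
    extend-to-linjection =
      let c , c-proper , extends = extend-colouring {colour} (λ {xs} {ys} → colour-proper {xs} {ys}) in
      f c , linjection (value c) (sparse c c-proper) ,
      λ (xs , b) b∈ → ∈⟦⟧⁺ (f? c) (extends (colour-complete b∈))
      where
      module _ (c : Vec (Fin (suc m)) d → Fin N) where

        f? : Decidable (λ (xs , b) → c xs ≡ b)
        f? (xs , b) = c xs Fin.≟ b

        f : SetOf Point
        f = ⟦ f? ⟧

        f⁻ : ∀ {xs b} → (xs , b) ∈ˢ f → c xs ≡ b
        f⁻ = ∈⟦⟧⁻ f?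

        value : ∀ xs → ∃! _≡_ λ b → f (xs , b) ≡ true
        value xs = c xs , ∈⟦⟧⁺ f? refl , f⁻

        -- A line in direction `zero` fixes `xs`, where `c` has one value. A line in direction
        -- `suc i` fixes the colour, and two distinct points of `f` on it would be adjacent vertices
        -- of equal colour.
        sparse : (∀ {xs ys} → Adj xs ys → c xs ≢ c ys) →
                 ∀ i p x y → OnLine i p x → OnLine i p y → f x ≡ true → f y ≡ true → x ≡ y
        sparse c-proper zero p (xs , a) (ys , b) xp yp fx fy =
          cong₂ _,_ xs≡ys (trans (sym (f⁻ fx)) (trans (cong c xs≡ys) (f⁻ fy)))
          where
          xs≡ys : xs ≡ ys
          xs≡ys = lookup-injective λ j → trans (xp (suc j) λ ()) (sym (yp (suc j) λ ()))
        sparse c-proper (suc i) p (xs , a) (ys , b) xp yp fx fy =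
          cong₂ _,_ (decidable-stable (xs ≟ ys) λ xs≢ys → c-proper (xs≢ys , i , off-i) cxs≡cys) a≡b
          where
          a≡b : a ≡ b
          a≡b = trans (xp zero λ ()) (sym (yp zero λ ()))

          cxs≡cys : c xs ≡ c ys
          cxs≡cys = trans (f⁻ fx) (trans a≡b (sym (f⁻ fy)))

          off-i : ∀ j → j ≢ i → lookup xs j ≡ lookup ys j
          off-i j j≢i = trans (xp (suc j) (j≢i ∘ Fin.suc-injective)) (sym (yp (suc j) (j≢i ∘ Fin.suc-injective)))

-- Comparing the two maxima.

max-ᾱ≤max-α : ∀ d m N → 2 ≤ d → d * m < N → Hypergraph.max-ᾱ d (suc m) N ≤ Cube.max-α d (suc m) N
max-ᾱ≤max-α d m N 2≤d few = maximum-least (λ H → IsPartite? H ×-dec IsUniform? H) λ H (partite , _) →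
  maximum-least (IsGoodFamily? H) λ K good →
    let open CliquesToCylinder good
        f , f-lin , S⊆f = Extension.extend-to-linjection d m N few S-sparse
    in ℕ.≤-trans (cardK≤cardS 2≤d partite) (card≤α f-lin S-cylinderIntersection S⊆f)
  where
  open Hypergraph d (suc m) N
  open Correspondence d (suc m) N

theorem15 : (k n N : ℕ) → 3 ≤ k → 1 ≤ n → n ≤ N →
    α k n N ≤ ᾱ k n N × (N > (k ∸ 1) * (n ∸ 1) → α k n N ≡ ᾱ k n N)
-- Once `k` is `suc d` and `n` is `suc m`, both truncated subtractions compute, and `few` becomes
-- the degree bound `d * m < N`.
theorem15 (suc d) (suc m) N (s≤s 2≤d) _ _ =
  α≤ᾱ , λ few → ℕ.≤-antisym α≤ᾱ (max-ᾱ≤max-α d m N 2≤d few)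
  where
  α≤ᾱ : α (suc d) (suc m) N ≤ ᾱ (suc d) (suc m) N
  α≤ᾱ = Correspondence.max-α≤max-ᾱ d (suc m) N 2≤d
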